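{- Let $n\geq1$. Every combinatorial torus cube packing in dimension $n$ with at least $2^n-3$ cubes is extensible, i.e. it either has $2^n$ cubes or a further combinatorial torus cube can be added to it keeping pairwise non-overlap.
   Context: A combinatorial torus cube in dimension $n$ is a formal cube $z+[0,1]^n$, $z=(z_1,\dots,z_n)$, with each $z_j$ equal to $t$ or $t+1$ for a formal parameter $t$, parameters in different coordinates being distinct. Two such cubes are non-overlapping if for some coordinate $j$, $z_j,z'_j$ involve the same parameter $t$ and $\{z_j,z'_j\}=\{t,t+1\}$. A combinatorial torus cube packing is a finite family of pairwise non-overlapping such cubes. It is non-extensible if it has fewer than $2^n$ cubes and no combinatorial torus cube (whose coordinates may use already occurring or new parameters) can be added keeping non-overlap; it is extensible otherwise. -}

module Defs where

open import Data.Nat using (ℕ; _≤_; _^_; _∸_)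
open import Data.Bool using (Bool; true; false)
open import Data.Fin using (Fin)
open import Data.Product using (Σ; ∃; _×_; _,_)
open import Data.Sum using (_⊎_)
open import Data.List using (List; length)
open import Data.List.Relation.Unary.All using (All)
open import Data.List.Relation.Unary.AllPairs using (AllPairs)
open import Relation.Binary.PropositionalEquality using (_≡_; _≢_)

-- Formal parameters are labelled by natural numbers.  Since parameters in
-- different coordinates are distinct, each coordinate has its own namespace
-- of parameters: a label ℕ at coordinate j denotes a parameter t_{j,label}.
-- The Bool records whether the coordinate is t (false) or t+1 (true).
record Entry : Set where
  constructor entry
  field
    param : ℕ
    plus1 : Bool
open Entry public

-- A combinatorial torus cube z + [0,1]^n in dimension n.
Cube : ℕ → Set
Cube n = Fin n → Entry

Opposite : Entry → Entry → Set
Opposite e e' = (param e ≡ param e') × (plus1 e ≢ plus1 e')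

NonOverlap : ∀ {n} → Cube n → Cube n → Set
NonOverlap {n} z z' = ∃ λ (j : Fin n) → Opposite (z j) (z' j)

IsPacking : ∀ {n} → List (Cube n) → Set
IsPacking P = AllPairs NonOverlap P

Extensible : ∀ {n} → List (Cube n) → Set
Extensible {n} P = (2 ^ n ≤ length P) ⊎ Σ (Cube n) (λ c → All (NonOverlap c) P)

{-# OPTIONS --safe #-}
module Submission where

-- The defect of a packing in dimension n is 2ⁿ minus its number of cubes. Fixing the first
-- coordinate of points to σ turns the packing into a packing of dimension n − 1, and the
-- defects at σ and at the complementary choice not ∘ σ add up to the defect of the packing.
-- If some section is full, or if the defect is 1 (so that some section is full), induction
-- gives a cube. Otherwise all sections have defect 1 or 2, and by induction each section of
-- defect 1 misses exactly one cube C(σ). Then C(σ) = C(σ') as soon as C(σ) meets a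
-- cube of the packing with first parameter t, σ and σ' agree at t, and both have defect 1:
-- otherwise C(σ) would contain a whole line. In defect 2 this suffices, as all sections
-- have defect 1. In defect 3 some flip at a parameter t changes the defect from 1 to 2;
-- either C(σ) is also missed after the flip, and the other cube missed there extends the
-- packing, or all sections with the same value at t miss the same cube C(σ).

open import Defs
open import Data.Bool using (Bool; true; false; not; if_then_else_)
open import Data.Bool.Properties using (not-involutive; ¬-not; not-¬)
  renaming (_≟_ to _≟ᵇ_)
open import Data.Fin using (Fin; zero; suc)
open import Data.Fin.Properties using (any?; ¬∀⟶∃¬) renaming (_≟_ to _≟ᶠ_)
open import Data.Nat using (ℕ; zero; suc; _+_; _≤_; _<_; _^_; _∸_; z≤n; s≤s)
open import Data.Nat.Properties
open import Data.List using (List; []; _∷_; length; map; filter)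
open import Data.List.Extrema.Nat using (max; xs≤max)
open import Data.List.Membership.Propositional using (_∈_; find)
open import Data.List.Membership.Propositional.Properties
  using (∈-map⁺; ∈-map⁻; ∈-filter⁺; ∈-filter⁻)
open import Data.List.Relation.Unary.All using (All; []; _∷_)
import Data.List.Relation.Unary.All as All
import Data.List.Relation.Unary.All.Properties as Allₚ
open import Data.List.Relation.Unary.AllPairs using ([]; _∷_)
open import Data.List.Relation.Unary.Any using (here; there)
open import Data.Product using (Σ; ∃; ∃₂; _×_; _,_; proj₁; proj₂)
open import Data.Sum using (_⊎_; inj₁; inj₂)
open import Data.Vec.Functional using (head; tail; updateAt) renaming (_∷_ to _◂_)
open import Data.Vec.Functional.Properties using (updateAt-updates; updateAt-minimal)
open import Algebra.Properties.CommutativeSemigroup +-commutativeSemigroup using (interchange)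
open import Function using (_∘_; const)
open import Relation.Nullary using (¬_; Dec; yes; no; does; contradiction)
open import Relation.Nullary.Decidable using (_×-dec_; ¬?)
open import Relation.Unary using (Decidable)
open import Relation.Binary.PropositionalEquality
  using (_≡_; _≢_; refl; sym; trans; cong; cong₂; subst)

-- Points of the torus and membership in cubes

-- A coordinate of a point is recorded by telling, for each parameter t,
-- whether it lies in [t, t+1) or in [t+1, t+2) modulo 2; all choices are allowed.
Coord : Set
Coord = ℕ → Bool

Point : ℕ → Set
Point n = Fin n → Coord

_∋_ : Coord → Entry → Set
σ ∋ e = σ (param e) ≡ plus1 e

_∋?_ : ∀ σ e → Dec (σ ∋ e)
σ ∋? e = σ (param e) ≟ᵇ plus1 e

_∈ᶜ_ : ∀ {n} → Point n → Cube n → Set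
x ∈ᶜ z = ∀ j → x j ∋ z j

opposite-disjoint : ∀ {e e'} σ → Opposite e e' → σ ∋ e → ¬ σ ∋ e'
opposite-disjoint σ (p≡ , b≢) σ∋e σ∋e' =
  b≢ (trans (sym σ∋e) (trans (cong σ p≡) σ∋e'))

opposite-sym : ∀ {e e'} → Opposite e e' → Opposite e' e
opposite-sym (p≡ , b≢) = sym p≡ , b≢ ∘ sym

∌⇒not∋ : ∀ σ e → ¬ σ ∋ e → (not ∘ σ) ∋ e
∌⇒not∋ σ e ∌ = trans (cong not (¬-not ∌)) (not-involutive (plus1 e))

flip : ℕ → Coord → Coord
flip t σ p with p ≟ t
... | yes _ = not (σ p)
... | no _  = σ p

flip-≡ : ∀ t σ {p} → p ≡ t → flip t σ p ≡ not (σ p)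
flip-≡ t σ {p} p≡t with p ≟ t
... | yes _   = refl
... | no p≢t = contradiction p≡t p≢t

flip-≢ : ∀ t σ {p} → p ≢ t → flip t σ p ≡ σ p
flip-≢ t σ {p} p≢t with p ≟ t
... | yes p≡t = contradiction p≡t p≢t
... | no _    = refl

flip-∌⇒param : ∀ t σ e → σ ∋ e → ¬ flip t σ ∋ e → param e ≡ t
flip-∌⇒param t σ e ∋e flip∌ with param e ≟ t
... | yes p≡t = p≡t
... | no p≢t  = contradiction ∋e flip∌

flip-∋⇒param : ∀ t σ e → ¬ σ ∋ e → flip t σ ∋ e → param e ≡ t
flip-∋⇒param t σ e ∌e flip∋ with param e ≟ t
... | yes p≡t = p≡t
... | no p≢t  = contradiction flip∋ ∌e

nonOverlap? : ∀ {n} (z c : Cube n) → Dec (NonOverlap z c)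
nonOverlap? z c =
  any? λ j → (param (z j) ≟ param (c j)) ×-dec ¬? (plus1 (z j) ≟ᵇ plus1 (c j))

nonOverlap-sym : ∀ {n} {z c : Cube n} → NonOverlap z c → NonOverlap c z
nonOverlap-sym (j , opp) = j , opposite-sym opp

nonOverlap-disjoint : ∀ {n} {z c : Cube n} x → NonOverlap z c → x ∈ᶜ z → ¬ x ∈ᶜ c
nonOverlap-disjoint x (j , opp) x∈z x∈c = opposite-disjoint (x j) opp (x∈z j) (x∈c j)

-- The two cubes ask for conflicting values at coordinate `j` only if their entries there are
-- opposite, so giving `z` priority yields a common point whenever `NonOverlap` fails.
meet : ∀ {n} → Cube n → Cube n → Point n
meet z c j p with p ≟ param (z j)
... | yes _ = plus1 (z j)
... | no _  = plus1 (c j)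

meet-∈ˡ : ∀ {n} (z c : Cube n) → meet z c ∈ᶜ z
meet-∈ˡ z c j with param (z j) ≟ param (z j)
... | yes _  = refl
... | no p≢p = contradiction refl p≢p

meet-∈ʳ : ∀ {n} (z c : Cube n) → ¬ NonOverlap z c → meet z c ∈ᶜ c
meet-∈ʳ z c meets j with param (c j) ≟ param (z j) | plus1 (z j) ≟ᵇ plus1 (c j)
... | yes _  | yes b≡ = b≡
... | yes p≡ | no b≢  = contradiction (j , sym p≡ , b≢) meets
... | no _   | _      = refl

-- Constancy in the parameter suffices: the new value at `k` is wrong for `C k`, so the point lies
-- outside `C` while staying on the line through `y` in direction `k`.
leave : ∀ {n} → Cube n → Fin n → Point n → Point n
leave C k y = updateAt y k (const (const (not (plus1 (C k)))))

Extension : ∀ {n} → List (Cube n) → Set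
Extension {n} P = Σ (Cube n) λ z → All (NonOverlap z) P

findOverlap : ∀ {n} (z : Cube n) P →
  All (NonOverlap z) P ⊎ ∃₂ λ c x → c ∈ P × x ∈ᶜ z × x ∈ᶜ c
findOverlap z P with All.all? (nonOverlap? z) P
... | yes disjoint = inj₁ disjoint
... | no ¬disjoint with find (Allₚ.¬All⇒Any¬ (nonOverlap? z) P ¬disjoint)
... | c , c∈P , meets =
  inj₂ (c , meet z c , c∈P , meet-∈ˡ z c , meet-∈ʳ z c meets)

-- `resolve` usually refutes the common point, but it may also answer with an extension found
-- elsewhere.
extendBy : ∀ {n} {P : List (Cube n)} (z : Cube n) →
  (∀ {c} x → c ∈ P → x ∈ᶜ z → x ∈ᶜ c → Extension P) → Extension P
extendBy {P = P} z resolve with findOverlap z P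
... | inj₁ disjoint                    = z , disjoint
... | inj₂ (c , x , c∈P , x∈z , x∈c) = resolve x c∈P x∈z x∈c

packing-pair : ∀ {n} {P : List (Cube n)} → IsPacking P → ∀ {c c'} → c ∈ P → c' ∈ P →
  c ≡ c' ⊎ NonOverlap c c'
packing-pair (_ ∷ _)  (here refl) (here refl) = inj₁ refl
packing-pair (d ∷ _)  (here refl) (there c'∈) = inj₂ (All.lookup d c'∈)
packing-pair (d ∷ _)  (there c∈)  (here refl) = inj₂ (nonOverlap-sym (All.lookup d c∈))
packing-pair (_ ∷ pk) (there c∈)  (there c'∈) = packing-pair pk c∈ c'∈

-- Sections by the first coordinate and their sizes

section : ∀ {m} → Coord → List (Cube (suc m)) → List (Cube m)
section σ P = map tail (filter (λ c → σ ∋? head c) P)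

∈-section⁺ : ∀ {m} {P : List (Cube (suc m))} σ {c} →
  c ∈ P → σ ∋ head c → tail c ∈ section σ P
∈-section⁺ σ c∈P σ∋ = ∈-map⁺ tail (∈-filter⁺ (λ c → σ ∋? head c) c∈P σ∋)

∈-section⁻ : ∀ {m} (P : List (Cube (suc m))) σ {z} → z ∈ section σ P →
  ∃ λ c → c ∈ P × σ ∋ head c × z ≡ tail c
∈-section⁻ P σ z∈ with ∈-map⁻ tail z∈
... | c , c∈ , z≡ with ∈-filter⁻ (λ c → σ ∋? head c) c∈
... | c∈P , σ∋ = c , c∈P , σ∋ , z≡

section-packing : ∀ {m} σ {P : List (Cube (suc m))} → IsPacking P → IsPacking (section σ P)
section-packing σ [] = []
section-packing σ {c ∷ P} (d ∷ pk) with σ ∋? head c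
... | no _   = section-packing σ pk
... | yes σ∋ = All.tabulate disjoint ∷ section-packing σ pk
  where
  disjoint : ∀ {z} → z ∈ section σ P → NonOverlap (tail c) z
  disjoint z∈ with ∈-section⁻ P σ z∈
  ... | c' , c'∈P , σ∋' , refl with All.lookup d c'∈P
  ... | zero , opp  = contradiction σ∋' (opposite-disjoint σ opp σ∋)
  ... | suc j , opp = j , opp

section-cong : ∀ {m} (σ σ' : Coord) {P : List (Cube (suc m))} →
  All (λ c → σ (param (head c)) ≡ σ' (param (head c))) P → section σ P ≡ section σ' P
section-cong σ σ' [] = refl
section-cong σ σ' {c ∷ P} (eq ∷ eqs) rewrite eq with σ' ∋? head c
... | yes _ = cong (tail c ∷_) (section-cong σ σ' eqs)
... | no _  = section-cong σ σ' eqs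

weight : Coord → Entry → ℕ
weight σ e = if does (σ ∋? e) then 1 else 0

length-section-∷ : ∀ {m} σ c (P : List (Cube (suc m))) →
  length (section σ (c ∷ P)) ≡ weight σ (head c) + length (section σ P)
length-section-∷ σ c P with does (σ ∋? head c)
... | true  = refl
... | false = refl

weight-not : ∀ σ e → weight σ e + weight (not ∘ σ) e ≡ 1
weight-not σ e with σ (param e) | plus1 e
... | false | false = refl
... | false | true  = refl
... | true  | false = refl
... | true  | true  = refl

weight-cong : ∀ σ σ' e → σ (param e) ≡ σ' (param e) → weight σ e ≡ weight σ' e
weight-cong σ σ' e eq rewrite eq = refl

length-sections : ∀ {m} σ (P : List (Cube (suc m))) →
  length (section σ P) + length (section (not ∘ σ) P) ≡ length P
length-sections σ [] = refl
length-sections σ (c ∷ P)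
  rewrite length-section-∷ σ c P | length-section-∷ (not ∘ σ) c P =
  trans (interchange (weight σ (head c)) _ (weight (not ∘ σ) (head c)) _)
        (cong₂ _+_ (weight-not σ (head c)) (length-sections σ P))

-- If `e` has parameter `t`, then `σ` and `σ'` give it equal weights both before and after the flip;
-- otherwise the flip changes no weight.
weight-flip : ∀ t σ σ' e → σ t ≡ σ' t →
  weight σ e + weight (flip t σ') e ≡ weight (flip t σ) e + weight σ' e
weight-flip t σ σ' e eq = go (param e ≟ t)
  where
  go : Dec (param e ≡ t) →
    weight σ e + weight (flip t σ') e ≡ weight (flip t σ) e + weight σ' e
  go (yes refl) = trans
    (cong₂ _+_ (weight-cong σ σ' e eq)
      (weight-cong (flip t σ') (flip t σ) e
        (trans (flip-≡ t σ' refl) (trans (cong not (sym eq)) (sym (flip-≡ t σ refl))))))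
    (+-comm (weight σ' e) _)
  go (no p≢t) = sym (cong₂ _+_
    (weight-cong (flip t σ) σ e (flip-≢ t σ p≢t))
    (sym (weight-cong (flip t σ') σ' e (flip-≢ t σ' p≢t))))

-- The effect of flipping t on the size of a section depends only on the value at t.
length-flip : ∀ {m} t σ σ' (P : List (Cube (suc m))) → σ t ≡ σ' t →
  length (section σ P) + length (section (flip t σ') P) ≡
  length (section (flip t σ) P) + length (section σ' P)
length-flip t σ σ' [] eq = refl
length-flip t σ σ' (c ∷ P) eq
  rewrite length-section-∷ σ c P | length-section-∷ (flip t σ') c P
        | length-section-∷ (flip t σ) c P | length-section-∷ σ' c P =
  trans (interchange (weight σ (head c)) _ (weight (flip t σ') (head c)) _)
  (trans (cong₂ _+_ (weight-flip t σ σ' (head c) eq) (length-flip t σ σ' P eq))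
         (interchange (weight (flip t σ) (head c)) (weight σ' (head c)) _ _))

-- Defects and full packings

Defect : ∀ {n} → List (Cube n) → ℕ → Set
Defect {n} P d = length P + d ≡ 2 ^ n


defects-+ : ∀ {A B a b N} → A + a ≡ N → B + b ≡ N → (A + B) + (a + b) ≡ N + N
defects-+ {A} {B} {a} {b} Aa Bb = trans (interchange A B a b) (cong₂ _+_ Aa Bb)

2^suc : ∀ m → 2 ^ suc m ≡ 2 ^ m + 2 ^ m
2^suc m = cong (2 ^ m +_) (+-identityʳ (2 ^ m))

length-≤ : ∀ {n} {P : List (Cube n)} → IsPacking P → length P ≤ 2 ^ n
length-≤ {zero} []                    = z≤n
length-≤ {zero} (_ ∷ [])              = s≤s z≤n
length-≤ {zero} (((() , _) ∷ _) ∷ (_ ∷ _))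
length-≤ {suc m} {P} pk = begin
  length P
    ≡⟨ length-sections σ P ⟨
  length (section σ P) + length (section (not ∘ σ) P)
    ≤⟨ +-mono-≤ (length-≤ (section-packing σ pk)) (length-≤ (section-packing (not ∘ σ) pk)) ⟩
  2 ^ m + 2 ^ m
    ≡⟨ 2^suc m ⟨
  2 ^ suc m ∎
  where
  open ≤-Reasoning
  σ : Coord
  σ = const false

defect : ∀ {n} {P : List (Cube n)} → IsPacking P → ∃ (Defect P)
defect pk = m≤n⇒∃[o]m+o≡n (length-≤ pk)

defect-sections : ∀ {m} σ (P : List (Cube (suc m))) {a b d} → Defect (section σ P) a →
  Defect (section (not ∘ σ) P) b → Defect P d → a + b ≡ d
defect-sections {m} σ P {a} {b} {d} da db dP = +-cancelˡ-≡ (length P) (a + b) d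
  (trans (cong (_+ (a + b)) (sym (length-sections σ P)))
  (trans (defects-+ {A = length (section σ P)} da db) (trans (sym (2^suc m)) (sym dP))))

defect-flip : ∀ {m} t σ σ' (P : List (Cube (suc m))) {a b a' b'} → σ t ≡ σ' t →
  Defect (section σ P) a → Defect (section (flip t σ) P) b →
  Defect (section σ' P) a' → Defect (section (flip t σ') P) b' → a + b' ≡ b + a'
defect-flip t σ σ' P {a} {b} {a'} {b'} eq da db da' db' =
  +-cancelˡ-≡ (A + B') (a + b') (b + a')
    (trans (defects-+ {A = A} da db')
    (trans (sym (defects-+ {A = length (section (flip t σ) P)} db da'))
           (cong (_+ (b + a')) (sym (length-flip t σ σ' P eq)))))
  where
  A B' : ℕ
  A  = length (section σ P)
  B' = length (section (flip t σ') P)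

Covered : ∀ {n} → List (Cube n) → Point n → Set
Covered P x = ∃ λ c → c ∈ P × x ∈ᶜ c

-- Complementary sections have defects with sum 0, so the section through `x` is full and induction
-- applies to it.
full-covers : ∀ {n} {P : List (Cube n)} → IsPacking P → Defect P 0 → ∀ x → Covered P x
full-covers {zero} {[]} pk () x
full-covers {zero} {c ∷ P} pk full x = c , here refl , λ ()
full-covers {suc m} {P} pk full x
  with defect (section-packing (x zero) pk) | defect (section-packing (not ∘ x zero) pk)
... | a , da | b , db with m+n≡0⇒m≡0 a (defect-sections (x zero) P da db full)
... | refl with full-covers (section-packing (x zero) pk) da (tail x)
... | z , z∈ , x∈z with ∈-section⁻ P (x zero) z∈
... | c , c∈P , σ∋ , refl = c , c∈P , λ { zero → σ∋ ; (suc j) → x∈z j }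

-- The inductive statement and paths of single flips

Extends : ℕ → Set
Extends n = ∀ {P : List (Cube n)} → IsPacking P → ∀ {d} → d ≤ 2 → Defect P (suc d) → Extension P

crossing : {Q : ℕ → Set} → Decidable Q → ∀ N → Q 0 → ¬ Q N → ∃ λ i → Q i × ¬ Q (suc i)
crossing Q? zero    q0 ¬qN = contradiction q0 ¬qN
crossing Q? (suc N) q0 ¬qN with Q? N
... | yes qN = N , qN , ¬qN
... | no ¬qN' = crossing Q? N q0 ¬qN'

-- Interpolates between `σ` and its complement, one parameter at a time.
flipBelow : ℕ → Coord → Coord
flipBelow zero    σ = σ
flipBelow (suc i) σ = flip i (flipBelow i σ)

flipBelow-≥ : ∀ N σ {p} → N ≤ p → flipBelow N σ p ≡ σ p
flipBelow-≥ zero    σ _   = refl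
flipBelow-≥ (suc N) σ N<p =
  trans (flip-≢ N (flipBelow N σ) (>⇒≢ N<p)) (flipBelow-≥ N σ (<⇒≤ N<p))

flipBelow-< : ∀ N σ {p} → p < N → flipBelow N σ p ≡ not (σ p)
flipBelow-< (suc N) σ {p} p<sN with p ≟ N
... | yes refl = cong not (flipBelow-≥ N σ ≤-refl)
... | no p≢N   = flipBelow-< N σ (≤∧≢⇒< (≤-pred p<sN) p≢N)

-- Holes of sections

module _ {m} {P : List (Cube (suc m))} (pk : IsPacking P) where

  stacked : ∀ {c c'} y → c ∈ P → c' ∈ P → y ∈ᶜ tail c → y ∈ᶜ tail c' →
    c ≡ c' ⊎ Opposite (head c) (head c')
  stacked y c∈ c'∈ y∈c y∈c' with packing-pair pk c∈ c'∈
  ... | inj₁ c≡c'          = inj₁ c≡c'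
  ... | inj₂ (zero , opp)  = inj₂ opp
  ... | inj₂ (suc j , opp) = contradiction (y∈c' j) (opposite-disjoint (y j) opp (y∈c j))

  -- `C` is exactly the set of points missed by the section at `σ`. Speaking of cubes of `P` instead
  -- of their tails keeps the first parameters available.
  record IsHole (σ : Coord) (C : Cube m) : Set where
    field
      avoids : ∀ {c} y → c ∈ P → σ ∋ head c → y ∈ᶜ C → ¬ y ∈ᶜ tail c
      covers : ∀ y → y ∈ᶜ C ⊎ ∃ λ c → c ∈ P × σ ∋ head c × y ∈ᶜ tail c
  open IsHole

  light-hole : Extends m → ∀ σ → Defect (section σ P) 1 → ∃ (IsHole σ)
  light-hole ext σ light with ext (section-packing σ pk) z≤n light
  ... | C , disjoint = C , record { avoids = av ; covers = cov }
    where
    av : ∀ {c} y → c ∈ P → σ ∋ head c → y ∈ᶜ C → ¬ y ∈ᶜ tail c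
    av y c∈ σ∋ = nonOverlap-disjoint y (All.lookup disjoint (∈-section⁺ σ c∈ σ∋))
    cov : ∀ y → y ∈ᶜ C ⊎ ∃ λ c → c ∈ P × σ ∋ head c × y ∈ᶜ tail c
    cov y with full-covers (disjoint ∷ section-packing σ pk)
                 (trans (cong suc (+-identityʳ _)) (trans (+-comm 1 _) light)) y
    ... | _ , here refl , y∈ = inj₁ y∈
    ... | _ , there z∈ , y∈ with ∈-section⁻ P σ z∈
    ... | c , c∈ , σ∋ , refl = inj₂ (c , c∈ , σ∋ , y∈)

  -- A cube `c''` covering `w` is `c` or has the first parameter of `c`. In the latter case it can
  -- be separated from `c'` only in direction `k`, so it has the same entry there as `c` and
  -- contains `y`, a point of the hole.
  hole-half-line : ∀ {σ C} → IsHole σ C → ∀ k y z w →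
    (∀ i → i ≢ k → z i ≡ y i) → (∀ i → i ≢ k → w i ≡ y i) →
    ∀ {c c' c''} → c ∈ P → c' ∈ P → param (head c) ≢ param (head c') →
    Opposite (tail c k) (tail c' k) → y ∈ᶜ C → y ∈ᶜ tail c → z ∈ᶜ tail c' →
    w k ∋ tail c k → c'' ∈ P → σ ∋ head c'' → ¬ w ∈ᶜ tail c''
  hole-half-line hole k y z w z~y w~y {c} {c'} {c''} c∈ c'∈ p≢ opp y∈C y∈c z∈c' wk c''∈ σ∋ w∈c''
    with stacked w c∈ c''∈ w∈c w∈c''
    where
    w∈c : w ∈ᶜ tail c
    w∈c i with i ≟ᶠ k
    ... | yes refl = wk
    ... | no i≢k rewrite w~y i i≢k = y∈c i
  ... | inj₁ refl = avoids hole y c∈ σ∋ y∈C y∈c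
  ... | inj₂ (p≡ , _) with packing-pair pk c''∈ c'∈
  ... | inj₁ refl             = p≢ p≡
  ... | inj₂ (zero , p≡' , _) = p≢ (trans p≡ p≡')
  ... | inj₂ (suc i , opp') with i ≟ᶠ k
  ... | no i≢k = opposite-disjoint (y i) opp' (subst (_∋ tail c'' i) (w~y i i≢k) (w∈c'' i))
                                              (subst (_∋ tail c' i) (z~y i i≢k) (z∈c' i))
  ... | yes refl = avoids hole y c''∈ σ∋ y∈C y∈c''
    where
    y∈c'' : y ∈ᶜ tail c''
    y∈c'' j with j ≟ᶠ k
    ... | no j≢k = subst (_∋ tail c'' j) (w~y j j≢k) (w∈c'' j)
    ... | yes refl = trans (cong (y k) (trans (proj₁ opp') (sym (proj₁ opp))))
      (trans (y∈c k) (trans (¬-not (proj₂ opp)) (sym (¬-not (proj₂ opp')))))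

  -- Otherwise c and c' are opposite at k, and their two halves cover the whole line
  -- in direction k, which would then lie in the hole.
  hole-line : ∀ {σ C} → IsHole σ C → ∀ k y z → (∀ i → i ≢ k → z i ≡ y i) →
    ∀ {c c'} → c ∈ P → c' ∈ P → y ∈ᶜ C → z ∈ᶜ C → y ∈ᶜ tail c → z ∈ᶜ tail c' →
    param (head c) ≡ param (head c')
  hole-line {σ} {C} hole k y z z~y {c} {c'} c∈ c'∈ y∈C z∈C y∈c z∈c' with packing-pair pk c∈ c'∈
  ... | inj₁ refl            = refl
  ... | inj₂ (zero , p≡ , _) = p≡
  ... | inj₂ (suc i , opp) with i ≟ᶠ k
  ... | no i≢k = contradiction (z∈c' i)
    (opposite-disjoint (z i) opp (subst (_∋ tail c i) (sym (z~y i i≢k)) (y∈c i)))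
  ... | yes refl with param (head c) ≟ param (head c')
  ... | yes p≡ = p≡
  -- This point of the line is outside the hole, so the section must cover it, in the half of `c` or
  -- in that of `c'`.
  ... | no p≢ with covers hole (leave C k y)
  ... | inj₁ w∈C = contradiction (trans (sym (w∈C k)) (cong (λ f → f (param (C k))) (updateAt-updates k y)))
                                 (not-¬ refl)
  ... | inj₂ (c'' , c''∈ , σ∋ , w∈c'') with leave C k y k ∋? tail c k
  ... | yes wk = contradiction w∈c''
    (hole-half-line hole k y z _ z~y (λ i → updateAt-minimal i k y) c∈ c'∈ p≢ opp y∈C y∈c z∈c' wk c''∈ σ∋)
  ... | no ¬wk = contradiction w∈c''
    (hole-half-line hole k z y _ (λ i i≢k → sym (z~y i i≢k))
      (λ i i≢k → trans (updateAt-minimal i k y i≢k) (sym (z~y i i≢k)))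
      c'∈ c∈ (p≢ ∘ sym) (opposite-sym opp) z∈C z∈c' y∈c
      (trans (cong (leave C k y k) (sym (proj₁ opp)))
        (trans (¬-not ¬wk) (sym (¬-not (proj₂ opp ∘ sym)))))
      c''∈ σ∋)

  -- All sections σ with the given value at t have the same hole C: where another hole
  -- leaves C along a line through y₀, hole-line applies.
  extend-constant-hole : ∀ {σ₀ C} → IsHole σ₀ C → ∀ {c} y₀ → c ∈ P → y₀ ∈ᶜ C → y₀ ∈ᶜ tail c →
    (∀ σ → σ (param (head c)) ≡ σ₀ (param (head c)) → Extension P ⊎ ∃ (IsHole σ)) →
    Extension P
  extend-constant-hole {σ₀} {C} hole₀ {c} y₀ c∈ y₀∈C y₀∈c holes =
    extendBy (entry t (σ₀ t) ◂ C) resolve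
    where
    t : ℕ
    t = param (head c)

    resolve : ∀ {c''} x → c'' ∈ P → x ∈ᶜ (entry t (σ₀ t) ◂ C) → x ∈ᶜ c'' → Extension P
    resolve {c''} x c''∈ x∈Z x∈c'' with holes (x zero) (x∈Z zero)
    ... | inj₁ e = e
    -- A cube covering `y₀` here would have first parameter `t`, where `x zero` and `σ₀` agree, and
    -- would thus meet `C` in the section at `σ₀`. Hence `y₀` lies in `C'`.
    ... | inj₂ (C' , hole) with covers hole y₀
    ... | inj₂ (c₁ , c₁∈ , σ∋ , y₀∈c₁) with stacked y₀ c∈ c₁∈ y₀∈c y₀∈c₁
    ... | inj₁ refl = contradiction y₀∈c (avoids hole₀ y₀ c∈ (trans (sym (x∈Z zero)) σ∋) y₀∈C)
    ... | inj₂ (p≡ , _) = contradiction y₀∈c₁ (avoids hole₀ y₀ c₁∈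
            (trans (cong σ₀ (sym p≡)) (trans (sym (x∈Z zero)) (trans (cong (x zero) p≡) σ∋))) y₀∈C)
    resolve {c''} x c''∈ x∈Z x∈c'' | inj₂ (C' , hole) | inj₁ y₀∈C'
      with ¬∀⟶∃¬ m _ (λ k → x (suc k) ∋? C' k)
             (λ y∈C' → avoids hole (tail x) c''∈ (x∈c'' zero) y∈C' (λ j → x∈c'' (suc j)))
    -- Moving `y₀` only in the direction `k` in which `tail x` leaves `C'` gives a point still in
    -- `C` but no longer in `C'`.
    ... | k , xk∉ with covers hole (updateAt y₀ k (const (x (suc k))))
    ... | inj₁ z∈C' = contradiction (subst (_∋ C' k) (updateAt-updates k y₀) (z∈C' k)) xk∉
    ... | inj₂ (c' , c'∈ , σ∋ , z∈c') =
      contradiction z∈c' (avoids hole₀ z c'∈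
        (trans (cong σ₀ (sym p≡)) (trans (sym (x∈Z zero)) (trans (cong (x zero) p≡) σ∋))) z∈C)
      where
      z : Point m
      z = updateAt y₀ k (const (x (suc k)))
      z∈C : z ∈ᶜ C
      z∈C i with i ≟ᶠ k
      ... | yes refl = subst (_∋ C k) (sym (updateAt-updates k y₀)) (x∈Z (suc k))
      ... | no i≢k   = subst (_∋ C i) (sym (updateAt-minimal i k y₀ i≢k)) (y₀∈C i)
      p≡ : t ≡ param (head c')
      p≡ = hole-line hole₀ k y₀ z (λ i → updateAt-minimal i k y₀) c∈ c'∈ y₀∈C z∈C y₀∈c z∈c'

  -- Packings with a full section

  section-defect-≤ : ∀ σ {a b d} → Defect (section σ P) a →
    Defect (section (not ∘ σ) P) b → Defect P d → a ≤ d
  section-defect-≤ σ {a} {b} da db dP = subst (a ≤_) (defect-sections σ P da db dP) (m≤m+n a b)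

  -- A point y missed by the section at not ∘ σ is covered in the full section at σ by a
  -- cube with some parameter t in the first coordinate. Then y is also missed after
  -- flipping σ at t only, and any cube z missed there may be placed over that half.
  extend-full-section : Extends m → ∀ {d} → d ≤ 2 → Defect P (suc d) →
    ∀ σ → Defect (section σ P) 0 → Extension P
  extend-full-section ext d≤2 dP σ full with defect (section-packing (not ∘ σ) pk)
  ... | b , db with defect-sections σ P full db dP
  ... | refl with ext (section-packing (not ∘ σ) pk) d≤2 db
  ... | z₀ , z₀# with full-covers (section-packing σ pk) full (meet z₀ z₀)
  ... | _ , t∈ , y∈c with ∈-section⁻ P σ t∈
  ... | c , c∈ , σ∋ , refl = build (defect (section-packing ρ pk)) (defect (section-packing (not ∘ ρ) pk))
    where
    t : ℕ
    t = param (head c)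
    ρ : Coord
    ρ = flip t σ
    y : Point m
    y = meet z₀ z₀

    y-missed : ¬ Covered (section ρ P) y
    y-missed (_ , z∈ , y∈z) with ∈-section⁻ P ρ z∈
    ... | c' , c'∈ , ρ∋ , refl with σ ∋? head c'
    ... | no σ∌ = nonOverlap-disjoint y
            (All.lookup z₀# (∈-section⁺ (not ∘ σ) c'∈ (∌⇒not∋ σ (head c') σ∌))) (meet-∈ˡ z₀ z₀) y∈z
    ... | yes σ∋' with stacked y c∈ c'∈ y∈c y∈z
    ... | inj₁ refl = not-¬ refl (trans (trans σ∋ (sym ρ∋)) (flip-≡ t σ refl))
    ... | inj₂ opp  = opposite-disjoint σ opp σ∋ σ∋'

    build : ∃ (Defect (section ρ P)) → ∃ (Defect (section (not ∘ ρ) P)) → Extension P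
    build (zero , dρ) _ = contradiction (full-covers (section-packing ρ pk) dρ y) y-missed
    build (suc a , dρ) (_ , dρ')
      with ext (section-packing ρ pk)
             (≤-trans (≤-pred (section-defect-≤ ρ dρ dρ' dP)) d≤2) dρ
    ... | z , z# = extendBy (entry t (ρ t) ◂ z) resolve
      where
      missed : ∀ {c'} x → c' ∈ P → ρ ∋ head c' → x ∈ᶜ z → ¬ x ∈ᶜ tail c'
      missed x c'∈ ρ∋ = nonOverlap-disjoint x (All.lookup z# (∈-section⁺ ρ c'∈ ρ∋))

      resolve : ∀ {c'} x → c' ∈ P → x ∈ᶜ (entry t (ρ t) ◂ z) → x ∈ᶜ c' → Extension P
      resolve {c'} x c'∈ x∈Z x∈c' with full-covers (section-packing σ pk) full (tail x)
      ... | _ , z'∈ , x∈z' with ∈-section⁻ P σ z'∈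
      -- If the flip drops `c₂`, its parameter is `t`. Then `c'` is `c₂` or opposite to it in the
      -- first coordinate, so `c'` also has parameter `t` and belongs to the section at `ρ`, which
      -- `z` avoids.
      ... | c₂ , c₂∈ , σ∋₂ , refl with ρ ∋? head c₂
      ... | yes ρ∋₂ = contradiction x∈z' (missed (tail x) c₂∈ ρ∋₂ (λ j → x∈Z (suc j)))
      ... | no ρ∌₂ with flip-∌⇒param t σ (head c₂) σ∋₂ ρ∌₂
                      | stacked (tail x) c₂∈ c'∈ x∈z' (λ j → x∈c' (suc j))
      ... | p≡ | inj₁ refl = contradiction
              (trans (cong ρ p≡) (trans (sym (x∈Z zero)) (trans (cong (x zero) (sym p≡)) (x∈c' zero)))) ρ∌₂
      ... | p≡ | inj₂ opp = contradiction (λ j → x∈c' (suc j))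
              (missed (tail x) c'∈ ρ∋' (λ j → x∈Z (suc j)))
        where
        p'≡ : param (head c') ≡ t
        p'≡ = trans (sym (proj₁ opp)) p≡
        ρ∋' : ρ ∋ head c'
        ρ∋' = trans (cong ρ p'≡) (trans (sym (x∈Z zero)) (trans (cong (x zero) (sym p'≡)) (x∈c' zero)))

  -- Defects 2 and 3

  bisect : Extends m → ∀ {d} → d ≤ 2 → Defect P (suc d) → ∀ σ →
    Extension P ⊎ ∃₂ λ a b → Defect (section σ P) (suc a) ×
                             Defect (section (not ∘ σ) P) (suc b) × a + suc b ≡ d
  bisect ext d≤2 dP σ with defect (section-packing σ pk) | defect (section-packing (not ∘ σ) pk)
  ... | zero , da  | _          = inj₁ (extend-full-section ext d≤2 dP σ da)
  ... | suc a , da | zero , db  = inj₁ (extend-full-section ext d≤2 dP (not ∘ σ) db)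
  ... | suc a , da | suc b , db = inj₂ (a , b , da , db , suc-injective (defect-sections σ P da db dP))

  extend-defect-2 : Extends m → Defect P 2 → Extension P
  extend-defect-2 ext dP = start (hole (const false))
    where
    hole : ∀ σ → Extension P ⊎ ∃ (IsHole σ)
    hole σ with bisect ext (s≤s z≤n) dP σ
    ... | inj₁ e                        = inj₁ e
    ... | inj₂ (zero , _ , light , _)   = inj₂ (light-hole ext σ light)
    ... | inj₂ (suc a , b , _ , _ , eq) = contradiction (suc-injective eq) (m+1+n≢0 a)

    start : Extension P ⊎ ∃ (IsHole (const false)) → Extension P
    start (inj₁ e) = e
    start (inj₂ (C , hole₀)) with findOverlap C (map tail P)
    -- `C` avoids all tails, so any first entry will do.
    ... | inj₁ C# = (entry 0 false ◂ C) , All.map (λ { (j , opp) → suc j , opp }) (Allₚ.map⁻ C#)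
    ... | inj₂ (_ , y , z∈ , y∈C , y∈z) with ∈-map⁻ tail z∈
    ... | c , c∈ , refl = extend-constant-hole hole₀ y c∈ y∈C y∈z (λ σ _ → hole σ)

  extend-across : Extends m → Defect P 3 → ∀ t σ → Defect (section σ P) 1 →
    Defect (section (flip t σ) P) 2 → Extension P
  extend-across ext dP t σ light heavy with light-hole ext σ light
  ... | C , hole with findOverlap C (section (flip t σ) P)
  ... | inj₂ (_ , y , z∈ , y∈C , y∈z) with ∈-section⁻ P (flip t σ) z∈
  ... | c , c∈ , ρ∋ , refl with flip-∋⇒param t σ (head c) (λ σ∋ → avoids hole y c∈ σ∋ y∈C y∈z) ρ∋
  ... | refl = extend-constant-hole hole y c∈ y∈C y∈z holes
    where
    holes : ∀ σ' → σ' t ≡ σ t → Extension P ⊎ ∃ (IsHole σ')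
    holes σ' eq with bisect ext ≤-refl dP σ'
    ... | inj₁ e                              = inj₁ e
    ... | inj₂ (zero , _ , light' , _)        = inj₂ (light-hole ext σ' light')
    ... | inj₂ (suc (suc a) , b , _ , _ , eq') =
      contradiction (suc-injective (suc-injective eq')) (m+1+n≢0 a)
    ... | inj₂ (suc zero , _ , heavy' , _)
      with defect (section-packing (flip t σ') pk) | defect (section-packing (not ∘ flip t σ') pk)
    -- The flip raises the defect by one at `σ'` as it does at `σ`, from 2 to 3. All of the defect
    -- is then on one side and the complementary section is full.
    ... | b , db | b' , db' with suc-injective (defect-flip t σ σ' P (sym eq) light heavy heavy' db)
    ... | refl with defect-sections (flip t σ') P db db' dP
    ... | refl = inj₁ (extend-full-section ext ≤-refl dP (not ∘ flip t σ') db')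
  extend-across ext dP t σ light heavy | C , hole | inj₁ C#
    -- With `C` added the heavy section has defect 1; the cube `E` it still misses is disjoint from
    -- `C`, hence covered by the light section.
    with ext (C# ∷ section-packing (flip t σ) pk) z≤n (trans (sym (+-suc _ 1)) heavy)
  ... | E , E#C ∷ E# = extendBy (entry t (flip t σ t) ◂ E) resolve
    where
    missed : ∀ {c} x → c ∈ P → flip t σ ∋ head c → x ∈ᶜ E → ¬ x ∈ᶜ tail c
    missed x c∈ ρ∋ = nonOverlap-disjoint x (All.lookup E# (∈-section⁺ (flip t σ) c∈ ρ∋))

    resolve : ∀ {c'} x → c' ∈ P → x ∈ᶜ (entry t (flip t σ t) ◂ E) → x ∈ᶜ c' → Extension P
    resolve {c'} x c'∈ x∈Z x∈c' with covers hole (tail x)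
    ... | inj₁ x∈C = contradiction x∈C (nonOverlap-disjoint (tail x) E#C (λ j → x∈Z (suc j)))
    ... | inj₂ (c , c∈ , σ∋ , x∈c) with flip t σ ∋? head c
    ... | yes ρ∋ = contradiction x∈c (missed (tail x) c∈ ρ∋ (λ j → x∈Z (suc j)))
    ... | no ρ∌ with flip-∌⇒param t σ (head c) σ∋ ρ∌
                   | stacked (tail x) c∈ c'∈ x∈c (λ j → x∈c' (suc j))
    ... | p≡ | inj₁ refl = contradiction
            (trans (cong (flip t σ) p≡) (trans (sym (x∈Z zero)) (trans (cong (x zero) (sym p≡)) (x∈c' zero)))) ρ∌
    ... | p≡ | inj₂ opp = contradiction (λ j → x∈c' (suc j))
            (missed (tail x) c'∈ ρ∋' (λ j → x∈Z (suc j)))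
      where
      p'≡ : param (head c') ≡ t
      p'≡ = trans (sym (proj₁ opp)) p≡
      ρ∋' : flip t σ ∋ head c'
      ρ∋' = trans (cong (flip t σ) p'≡)
        (trans (sym (x∈Z zero)) (trans (cong (x zero) (sym p'≡)) (x∈c' zero)))

  extend-from-light : Extends m → Defect P 3 → ∀ σ → Defect (section σ P) 1 → Extension P
  extend-from-light ext dP σ light
    with crossing {Q = λ i → Defect (section (flipBelow i σ) P) 1} (λ _ → _ ≟ _) N light ¬light
    where
    N : ℕ
    -- Beyond every first parameter, so flipping below `N` gives the complementary section, whose
    -- defect is 2.
    N = suc (max 0 (map (param ∘ head) P))
    ¬light : ¬ Defect (section (flipBelow N σ) P) 1
    ¬light light' with defect-sections σ P light
        (subst (λ S → Defect S 1) (section-cong (flipBelow N σ) (not ∘ σ)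
          (All.map (λ p≤ → flipBelow-< N σ (s≤s p≤)) (Allₚ.map⁻ (xs≤max 0 (map (param ∘ head) P))))) light') dP
    ... | ()
  ... | i , lightᵢ , ¬lightᵢ₊₁ with bisect ext ≤-refl dP (flipBelow (suc i) σ)
  ... | inj₁ e                          = e
  ... | inj₂ (zero , _ , light' , _)    = contradiction light' ¬lightᵢ₊₁
  -- A single flip at `i` takes the defect from 1 to 2.
  ... | inj₂ (suc zero , _ , heavy , _) = extend-across ext dP i (flipBelow i σ) lightᵢ heavy
  ... | inj₂ (suc (suc a) , b , _ , _ , eq) =
    contradiction (suc-injective (suc-injective eq)) (m+1+n≢0 a)

  extend-defect-3 : Extends m → Defect P 3 → Extension P
  extend-defect-3 ext dP with bisect ext ≤-refl dP (const false)
  ... | inj₁ e                                = e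
  ... | inj₂ (zero , _ , light , _)           = extend-from-light ext dP (const false) light
  ... | inj₂ (suc zero , zero , _ , light , _) = extend-from-light ext dP (const true) light
  ... | inj₂ (suc zero , suc _ , _ , _ , ())
  ... | inj₂ (suc (suc a) , b , _ , _ , eq)   =
    contradiction (suc-injective (suc-injective eq)) (m+1+n≢0 a)

-- Induction on the dimension

extends : ∀ n → Extends n
extends zero {[]}    _  _ _  = (λ ()) , []
extends zero {c ∷ P} _  _ dP = contradiction (suc-injective dP) (m+1+n≢0 (length P))
extends (suc m) pk {zero} d≤2 dP with bisect pk (extends m) d≤2 dP (const false)
... | inj₁ e                      = e
... | inj₂ (a , _ , _ , _ , eq) = contradiction eq (m+1+n≢0 a)
extends (suc m) pk {suc zero}       _ dP = extend-defect-2 pk (extends m) dP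
extends (suc m) pk {suc (suc zero)} _ dP = extend-defect-3 pk (extends m) dP
extends (suc m) pk {suc (suc (suc _))} (s≤s (s≤s ())) _

theorem9 : (n : ℕ) → 1 ≤ n → (P : List (Cube n)) → IsPacking P →
    2 ^ n ∸ 3 ≤ length P → Extensible P
theorem9 n _ P pk large with defect pk
... | zero , full   = inj₁ (≤-reflexive (trans (sym full) (+-identityʳ (length P))))
... | suc d , dP = inj₂ (extends n pk (≤-pred (+-cancelˡ-≤ (length P) (suc d) 3 bound)) dP)
  where
  open ≤-Reasoning
  bound : length P + suc d ≤ length P + 3
  bound = begin
    length P + suc d ≡⟨ dP ⟩
    -- Also valid when the subtraction truncates, as for `n` equal to 1.
    2 ^ n            ≤⟨ m≤n+m∸n (2 ^ n) 3 ⟩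
    3 + (2 ^ n ∸ 3)  ≤⟨ +-monoʳ-≤ 3 large ⟩
    3 + length P     ≡⟨ +-comm 3 (length P) ⟩
    length P + 3     ∎
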